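{- Let $G=(V,E)$ be a finite, simple, connected AT-free graph. Then for every vertex $s \in V$ there is a linear vertex ordering $\tau = (s=v_1,\ldots,v_n)$ of $V$ that is simultaneously an AT-free order of $G$ and a BFS order of $G$ (starting in $s$).
   Context: An asteroidal triple of $G$ is an independent set of three vertices such that for any two of them there is a path between them containing no neighbour of the third; $G$ is AT-free if it has no asteroidal triple. A path $P$ avoids a vertex $v$ if $v$ has no neighbour on $P$. The domination betweenness $\mathcal{B}_D(G)$ is the set of triples $(x,y,z)$ of distinct vertices such that there is a chordless (induced) $x$-$y$-path that avoids $z$ and a chordless $y$-$z$-path that avoids $x$. An AT-free order of $G$ is a linear ordering $\tau$ of $V$ such that for every $(x,y,z) \in \mathcal{B}_D(G)$ we have $y \prec_\tau x$ or $y \prec_\tau z$. A BFS order starting in $s$ is an ordering of $V$ that can be produced by a breadth-first search started at $s$ (with some tie-breaking). -}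

module Defs where

open import Data.Nat using (ℕ; suc) renaming (_<_ to _<ℕ_)
open import Data.Fin using (Fin; toℕ; zero; _<_; _≤_)
open import Data.Fin.Permutation using (Permutation′; _⟨$⟩ʳ_; _⟨$⟩ˡ_)
open import Data.Bool using (Bool; true; false)
open import Data.List using (List; []; _∷_; length; lookup)
open import Data.List.Relation.Unary.All using (All)
open import Data.List.Relation.Unary.Unique.Propositional using (Unique)
open import Data.Product using (Σ; ∃; ∃-syntax; _×_; _,_)
open import Data.Sum using (_⊎_)
open import Relation.Nullary using (¬_)
open import Relation.Binary.PropositionalEquality using (_≡_; _≢_)

record Graph (n : ℕ) : Set where
  field
    adj    : Fin n → Fin n → Bool
    sym    : ∀ u v → adj u v ≡ adj v u
    irrefl : ∀ v → adj v v ≡ false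

module _ {n : ℕ} (G : Graph n) where
  open Graph G

  E : Fin n → Fin n → Set
  E u v = adj u v ≡ true

  data Walk : Fin n → Fin n → List (Fin n) → Set where
    single : (x : Fin n) → Walk x x (x ∷ [])
    step   : ∀ {x y z p} → E x y → Walk y z p → Walk x z (x ∷ p)

  IsPath : Fin n → Fin n → List (Fin n) → Set
  IsPath x y p = Walk x y p × Unique p

  Chordless : List (Fin n) → Set
  Chordless p = ∀ (i j : Fin (length p)) → suc (toℕ i) <ℕ toℕ j →
                ¬ E (lookup p i) (lookup p j)

  IsChordlessPath : Fin n → Fin n → List (Fin n) → Set
  IsChordlessPath x y p = IsPath x y p × Chordless p

  Avoids : List (Fin n) → Fin n → Set
  Avoids p v = All (λ u → ¬ E v u) p

  Connected : Set
  Connected = ∀ u v → ∃[ p ] IsPath u v p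

  AsteroidalTriple : Fin n → Fin n → Fin n → Set
  AsteroidalTriple x y z =
    (x ≢ y × y ≢ z × x ≢ z) ×
    (¬ E x y × ¬ E y z × ¬ E x z) ×
    (∃[ p ] (IsPath x y p × Avoids p z)) ×
    (∃[ p ] (IsPath y z p × Avoids p x)) ×
    (∃[ p ] (IsPath x z p × Avoids p y))

  ATFree : Set
  ATFree = ∀ x y z → ¬ AsteroidalTriple x y z

  InDomBetweenness : Fin n → Fin n → Fin n → Set
  InDomBetweenness x y z =
    (x ≢ y × y ≢ z × x ≢ z) ×
    (∃[ p ] (IsChordlessPath x y p × Avoids p z)) ×
    (∃[ p ] (IsChordlessPath y z p × Avoids p x))

  -- Linear orderings of V are permutations τ : positions ↔ vertices;
  -- τ ⟨$⟩ʳ i is the vertex at position i, τ ⟨$⟩ˡ v the position of v.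
  _≺[_]_ : Fin n → Permutation′ n → Fin n → Set
  u ≺[ τ ] v = (τ ⟨$⟩ˡ u) < (τ ⟨$⟩ˡ v)

  ATFreeOrder : Permutation′ n → Set
  ATFreeOrder τ = ∀ x y z → InDomBetweenness x y z →
                  (y ≺[ τ ] x) ⊎ (y ≺[ τ ] z)

  private
    HasNeighbourAfter : Permutation′ n → Fin n → Fin n → Set
    HasNeighbourAfter τ k i = ∃[ m ] (i < m × E (τ ⟨$⟩ʳ k) (τ ⟨$⟩ʳ m))

  -- BFS order starting in s (generic BFS / queue semantics): τ starts
  -- with s, and each next vertex (position j, visited so far: positions < j)
  -- is a neighbour of the earliest visited vertex that still has an
  -- unvisited neighbour; if no visited vertex has an unvisited neighbour,
  -- any unvisited vertex may be chosen (a new BFS phase).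
  BFSOrder : Fin n → Permutation′ n → Set
  BFSOrder s τ =
    (∀ (z : Fin n) → toℕ z ≡ 0 → τ ⟨$⟩ʳ z ≡ s) ×
    (∀ (i j : Fin n) → toℕ j ≡ suc (toℕ i) →
       (∃[ k ] (k ≤ i × E (τ ⟨$⟩ʳ k) (τ ⟨$⟩ʳ j) ×
                (∀ k′ → k′ < k → ¬ HasNeighbourAfter τ k′ i)))
       ⊎ (∀ k → k ≤ i → ¬ HasNeighbourAfter τ k i))

{-# OPTIONS --safe #-}
-- Let C_v(b) be the component of b in G − N[v] (empty if b ∈ N[v]).  If y is between x
-- and v in an AT-free graph, then for every base b either |C_y(b)| < |C_v(b)|, or
-- |C_y(b)| < |C_x(b)|, or |C_y(b)| is at most both; for b = x the first holds.  Hence y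
-- cannot be lexicographically ≥ both x and v with respect to the vectors (|C_v(b)|)_b,
-- whatever the order of the bases.  Run BFS from s, breaking ties by this vector with
-- first base s.
-- Suppose that y comes last in a triple x ≺ v ≺ y, and let u be the BFS parent of v.
-- If y ≁ u, then the BFS tree path from x to v avoids y, so x, y, v is an asteroidal
-- triple.  If y ~ u, then v was preferred to y; either x has parent u, and so was also
-- preferred to y, or the tree path from s to x avoids both v and y, which forces
-- |C_y(s)| < |C_v(s)|.  Both are contradictory.
module Submission where

open import Defs
open import Data.Bool using (true)
import Data.Bool.Properties as Bool
open import Data.Empty using (⊥)
open import Data.Fin as Fin using (Fin; toℕ; fromℕ<)
open import Data.Fin.Permutation using (Permutation′; permutation; _⟨$⟩ˡ_; inverseʳ)
open import Data.Fin.Properties using (_≟_; any?; toℕ<n; toℕ-injective; toℕ-fromℕ<; injective⇒≤; ¬∀⟶∃¬)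
open import Data.Fin.Subset using (Subset; _∈_; ∣_∣)
open import Data.Fin.Subset.Properties using (p⊆q⇒∣p∣≤∣q∣; p⊂q⇒∣p∣<∣q∣)
open import Data.List using (List; []; _∷_; length; lookup; map; filter; allFin)
import Data.List.Extrema as Extrema
import Data.List.Membership.DecPropositional as DecMembership
open import Data.List.Membership.Propositional using () renaming (_∈_ to _∈ₗ_; _∉_ to _∉ₗ_)
open import Data.List.Membership.Propositional.Properties using (∈-allFin; ∈-filter⁺; ∈-filter⁻; ∈-lookup)
import Data.List.Membership.Setoid.Properties as SetoidMembership
open import Data.List.Relation.Binary.Lex.Core using (Lex-≤; this; next)
open import Data.List.Relation.Binary.Lex.Strict using (≤-decTotalOrder)
open import Data.List.Relation.Unary.All as All using (All; []; _∷_)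
open import Data.List.Relation.Unary.All.Properties using (¬Any⇒All¬)
open import Data.List.Relation.Unary.AllPairs using ([]; _∷_)
open import Data.List.Relation.Unary.Any as Any using (here; there)
open import Data.List.Relation.Unary.Unique.Propositional using (Unique)
open import Data.Nat using (ℕ; zero; suc; _<_; _≤_; z≤n; s≤s; z<s; _<?_)
open import Data.Nat.Induction using (<-rec)
open import Data.Nat.Properties using (≤-refl; ≤-reflexive; ≤-trans; ≤-pred; <-trans; <-≤-trans; ≤-<-trans; <-irrefl; <⇒≤; <⇒≱; ≮⇒≥; m≤n⇒m<n∨m≡n; m≤n⇒m≤1+n; <-cmp; <-strictTotalOrder)
open import Data.Product using (∃-syntax; _×_; _,_; proj₁; proj₂)
open import Data.Sum using (_⊎_; inj₁; inj₂; map₂; [_,_])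
open import Data.Vec using (tabulate)
open import Data.Vec.Properties using ([]=⇒lookup; lookup⇒[]=; lookup∘tabulate)
open import Function using (_∘_; id)
open import Relation.Binary using (DecTotalOrder; tri<; tri≈; tri>)
open import Relation.Binary.PropositionalEquality using (_≡_; _≢_; refl; sym; trans; cong; subst; setoid)
open import Relation.Nullary using (¬_; Dec; yes; no; does; contradiction; ¬?; _×-dec_; _⊎-dec_)
open import Relation.Nullary.Decidable using (map′; dec-true)
open import Relation.Unary using (Pred; Decidable)
open import Level using (0ℓ)

-- Finite sets and repetition-free lists of vertices.

module _ {n : ℕ} where

  Unique-lookup-injective : ∀ {xs : List (Fin n)} → Unique xs →
                            ∀ {i j} → lookup xs i ≡ lookup xs j → i ≡ j
  Unique-lookup-injective (_ ∷ _) {Fin.zero} {Fin.zero} _ = refl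
  Unique-lookup-injective {x ∷ xs} (x∉ ∷ _) {Fin.zero} {Fin.suc j} eq =
    contradiction eq (All.lookup x∉ (∈-lookup j))
  Unique-lookup-injective {x ∷ xs} (x∉ ∷ _) {Fin.suc i} {Fin.zero} eq =
    contradiction (sym eq) (All.lookup x∉ (∈-lookup i))
  Unique-lookup-injective (_ ∷ u) {Fin.suc _} {Fin.suc _} eq =
    cong Fin.suc (Unique-lookup-injective u eq)

  Unique⇒length≤ : ∀ {xs : List (Fin n)} → Unique xs → length xs ≤ n
  Unique⇒length≤ u = injective⇒≤ (Unique-lookup-injective u)

  open DecMembership (_≟_ {n}) public using (_∈?_)

  -- Pigeonhole: if every vertex occurred in `xs`, sending each to its index would inject `n`
  -- vertices into fewer positions.
  length<⇒∃∉ : ∀ (xs : List (Fin n)) → length xs < n → ∃[ v ] v ∉ₗ xs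
  length<⇒∃∉ xs len<n = ¬∀⟶∃¬ n (_∈ₗ xs) (_∈? xs) λ all →
    <⇒≱ len<n (injective⇒≤ {f = λ v → Any.index (all v)}
      λ {u} {v} → SetoidMembership.index-injective (setoid _) (all u) (all v))

  ⟦_⟧ : {P : Pred (Fin n) 0ℓ} → Decidable P → Subset n
  ⟦ P? ⟧ = tabulate (does ∘ P?)

  module _ {P : Pred (Fin n) 0ℓ} (P? : Decidable P) where

    ∈⟦⟧⁺ : ∀ {v} → P v → v ∈ ⟦ P? ⟧
    ∈⟦⟧⁺ {v} Pv = lookup⇒[]= v _ (trans (lookup∘tabulate _ v) (dec-true (P? v) Pv))

    ∈⟦⟧⁻ : ∀ {v} → v ∈ ⟦ P? ⟧ → P v
    ∈⟦⟧⁻ {v} v∈ with P? v | trans (sym (lookup∘tabulate (does ∘ P?) v)) ([]=⇒lookup v∈)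
    ... | yes Pv | _ = Pv
    ... | no _   | ()

  module _ {P Q : Pred (Fin n) 0ℓ} (P? : Decidable P) (Q? : Decidable Q) where

    ∣⟦⟧∣-mono-≤ : (∀ {v} → P v → Q v) → ∣ ⟦ P? ⟧ ∣ ≤ ∣ ⟦ Q? ⟧ ∣
    ∣⟦⟧∣-mono-≤ P⊆Q = p⊆q⇒∣p∣≤∣q∣ (∈⟦⟧⁺ Q? ∘ P⊆Q ∘ ∈⟦⟧⁻ P?)

    ∣⟦⟧∣-mono-< : (∀ {v} → P v → Q v) → ∀ {v} → Q v → ¬ P v → ∣ ⟦ P? ⟧ ∣ < ∣ ⟦ Q? ⟧ ∣
    ∣⟦⟧∣-mono-< P⊆Q Qv ¬Pv =
      p⊂q⇒∣p∣<∣q∣ (∈⟦⟧⁺ Q? ∘ P⊆Q ∘ ∈⟦⟧⁻ P? , _ , ∈⟦⟧⁺ Q? Qv , ¬Pv ∘ ∈⟦⟧⁻ P?)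

-- Lexicographic comparison and lexicographic minima.

_≤ₗ_ : List ℕ → List ℕ → Set
_≤ₗ_ = Lex-≤ _≡_ _<_

≤ₗ-head : ∀ {a b as bs} → (a ∷ as) ≤ₗ (b ∷ bs) → a ≤ b
≤ₗ-head (this a<b)   = <⇒≤ a<b
≤ₗ-head (next a≡b _) = ≤-reflexive a≡b

≤ₗ-tail : ∀ {a b as bs} → b ≤ a → (a ∷ as) ≤ₗ (b ∷ bs) → as ≤ₗ bs
≤ₗ-tail b≤a (this a<b) = contradiction b≤a (<⇒≱ a<b)
≤ₗ-tail _   (next _ r) = r

private module Lexₗ = Extrema (DecTotalOrder.totalOrder (≤-decTotalOrder <-strictTotalOrder))

module _ {A : Set} (default : A) (key : A → List ℕ) where

  pick : List A → A
  pick []       = default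
  pick (x ∷ xs) = Lexₗ.argmin key x xs

  pick-∈ : ∀ {x xs} → x ∈ₗ xs → pick xs ∈ₗ xs
  pick-∈ {xs = y ∷ ys} _ with Lexₗ.argmin-sel key y ys
  ... | inj₁ eq = here eq
  ... | inj₂ ∈  = there ∈

  pick-≤ : ∀ {x xs} → x ∈ₗ xs → key (pick xs) ≤ₗ key x
  pick-≤ {xs = y ∷ ys} (here refl) = Lexₗ.f[argmin]≤f[⊤] {f = key} y ys
  pick-≤ {xs = y ∷ ys} (there x∈)  = All.lookup (Lexₗ.f[argmin]≤f[xs] {f = key} y ys) x∈

module _ {n : ℕ} (G : Graph n) where
  open Graph G using (adj) renaming (sym to adj-sym)

  private
    V : Set
    V = Fin n

  infix 4 _~_
  _~_ : V → V → Set
  _~_ = E G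

  ~-sym : ∀ {u v} → u ~ v → v ~ u
  ~-sym {u} {v} = trans (adj-sym v u)

  _~?_ : ∀ u v → Dec (u ~ v)
  u ~? v = adj u v Bool.≟ true

  -- Connectivity inside an induced subgraph

  data Conn (P : Pred V 0ℓ) : V → V → Set where
    end  : ∀ {a} → P a → Conn P a a
    cons : ∀ {a b c} → P a → a ~ b → Conn P b c → Conn P a c

  module _ {P : Pred V 0ℓ} where

    Conn-source : ∀ {a b} → Conn P a b → P a
    Conn-source (end Pa)      = Pa
    Conn-source (cons Pa _ _) = Pa

    Conn-trans : ∀ {a b c} → Conn P a b → Conn P b c → Conn P a c
    Conn-trans (end _)       q = q
    Conn-trans (cons Pa e p) q = cons Pa e (Conn-trans p q)

    Conn-snoc : ∀ {a b c} → Conn P a b → b ~ c → P c → Conn P a c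
    Conn-snoc (end Pa)       e Pc = cons Pa e (end Pc)
    Conn-snoc (cons Pa e′ p) e Pc = cons Pa e′ (Conn-snoc p e Pc)

    Conn-sym : ∀ {a b} → Conn P a b → Conn P b a
    Conn-sym (end Pa)      = end Pa
    Conn-sym (cons Pa e p) = Conn-snoc (Conn-sym p) (~-sym e) Pa

    Conn-target : ∀ {a b} → Conn P a b → P b
    Conn-target = Conn-source ∘ Conn-sym

    -- The walk is followed from `a` until it first leaves `Q`; if it does, `w` is the vertex where
    -- that happens.
    Conn-exit : ∀ {Q : Pred V 0ℓ} → Decidable Q → ∀ {a b} → Conn P a b →
                Conn Q a b ⊎ (∃[ w ] (Conn P a w × ¬ Q w))
    Conn-exit Q? {a} p with Q? a
    ... | no ¬Qa = inj₂ (a , end (Conn-source p) , ¬Qa)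
    Conn-exit Q? (end _) | yes Qa = inj₁ (end Qa)
    Conn-exit Q? (cons Pa e p) | yes Qa with Conn-exit Q? p
    ... | inj₁ q             = inj₁ (cons Qa e q)
    ... | inj₂ (w , q , ¬Qw) = inj₂ (w , cons Pa e q , ¬Qw)

    path-suffix : ∀ {a b c p} → a ∈ₗ p → IsPath G b c p → All P p →
                  ∃[ q ] (IsPath G a c q × All P q)
    path-suffix (here refl) π@(single _ , _)   Pp = _ , π , Pp
    path-suffix (here refl) π@(step _ _ , _)   Pp = _ , π , Pp
    path-suffix (there a∈)  (step _ w , _ ∷ u) (_ ∷ Pp) = path-suffix a∈ (w , u) Pp

    Conn⇒path : ∀ {a b} → Conn P a b → ∃[ p ] (IsPath G a b p × All P p)
    Conn⇒path {a} (end Pa) = a ∷ [] , (single a , [] ∷ []) , Pa ∷ []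
    Conn⇒path {a} (cons Pa e c) with Conn⇒path c
    ... | p , (w , u) , Pp with a ∈? p
    ...   | yes a∈ = path-suffix a∈ (w , u) Pp
    ...   | no a∉  = a ∷ p , (step e w , ¬Any⇒All¬ p a∉ ∷ u) , Pa ∷ Pp

    -- The number bounds the vertices of a walk, so the relation can be decided by recursion. A path
    -- has at most `n` vertices, so the bound `n` decides `Conn`.
    ConnWithin : ℕ → V → V → Set
    ConnWithin zero    a b = ⊥
    ConnWithin (suc k) a b = P a × (a ≡ b ⊎ (∃[ c ] (a ~ c × ConnWithin k c b)))

    ConnWithin⇒Conn : ∀ k {a b} → ConnWithin k a b → Conn P a b
    ConnWithin⇒Conn (suc k) (Pa , inj₁ refl)        = end Pa
    ConnWithin⇒Conn (suc k) (Pa , inj₂ (_ , e , c)) = cons Pa e (ConnWithin⇒Conn k c)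

    walk⇒ConnWithin : ∀ {k a b p} → Walk G a b p → All P p → length p ≤ k → ConnWithin k a b
    walk⇒ConnWithin (single _) (Pa ∷ _)  (s≤s _) = Pa , inj₁ refl
    walk⇒ConnWithin (step e w) (Pa ∷ Pp) (s≤s l) = Pa , inj₂ (_ , e , walk⇒ConnWithin w Pp l)

    ConnWithin? : Decidable P → ∀ k a b → Dec (ConnWithin k a b)
    ConnWithin? P? zero    a b = no id
    ConnWithin? P? (suc k) a b =
      P? a ×-dec (a ≟ b ⊎-dec any? (λ c → a ~? c ×-dec ConnWithin? P? k c b))

    Conn? : Decidable P → ∀ a b → Dec (Conn P a b)
    Conn? P? a b = map′ (ConnWithin⇒Conn n) complete (ConnWithin? P? n a b)
      where
      complete : Conn P a b → ConnWithin n a b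
      complete c with Conn⇒path c
      ... | p , (w , u) , Pp = walk⇒ConnWithin w Pp (Unique⇒length≤ u)

  walk-boundary : ∀ {Q : Pred V 0ℓ} → Decidable Q → ∀ {a b p} → Walk G a b p → Q a → ¬ Q b →
                  ∃[ c ] ∃[ d ] (Q c × ¬ Q d × c ~ d)
  walk-boundary Q? (single _) Qa ¬Qa = contradiction Qa ¬Qa
  walk-boundary Q? (step {y = c} e w) Qa ¬Qb with Q? c
  ... | yes Qc = walk-boundary Q? w Qc ¬Qb
  ... | no ¬Qc = _ , _ , Qa , ¬Qc , e

  -- Components of G − N[v]

  Far : V → Pred V 0ℓ
  Far v u = u ≢ v × ¬ v ~ u

  Far? : ∀ v → Decidable (Far v)
  Far? v u = ¬? (u ≟ v) ×-dec ¬? (v ~? u)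

  Far-sym : ∀ {u v} → Far v u → Far u v
  Far-sym (u≢v , v≁u) = u≢v ∘ sym , v≁u ∘ ~-sym

  R : V → V → V → Set
  R v = Conn (Far v)

  R? : ∀ v a b → Dec (R v a b)
  R? v = Conn? (Far? v)

  walk⇒R : ∀ {v a b p} → a ≢ v → Walk G a b p → Avoids G p v → R v a b
  walk⇒R a≢v (single _) (v≁a ∷ _)  = end (a≢v , v≁a)
  walk⇒R a≢v (step e w) (v≁a ∷ av) =
    -- `Avoids` excludes only the neighbours of `v`. The next vertex cannot be `v` itself either,
    -- because `a` would then be a neighbour of `v`.
    cons (a≢v , v≁a) e (walk⇒R (λ { refl → v≁a (~-sym e) }) w av)

  R⇒path : ∀ {v a b} → R v a b → ∃[ p ] (IsPath G a b p × Avoids G p v)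
  R⇒path c with Conn⇒path c
  ... | p , π , far = p , π , All.map proj₂ far

  -- If the walk from `b` meets N[v], it does so first at `v` or at a neighbour of `v`. As `v` is
  -- outside N[y], the walk up to there extends to `v` within G - N[y].
  R-swap : ∀ {v y b z} → Far y v → R y b z → R v b z ⊎ R y b v
  R-swap {v} far c with Conn-exit (Far? v) c
  ... | inj₁ c′ = inj₁ c′
  ... | inj₂ (w , c′ , near) with w ≟ v
  ...   | yes refl = inj₂ c′
  ...   | no w≢v with v ~? w
  ...     | yes v~w = inj₂ (Conn-snoc c′ (~-sym v~w) far)
  ...     | no v≁w  = contradiction (w≢v , v≁w) near

  R-⊆ : ∀ {v y b} → Far y v → ¬ R y b v → ∀ {z} → R y b z → R v b z
  R-⊆ far ¬r r with R-swap far r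
  ... | inj₁ r′ = r′
  ... | inj₂ r′ = contradiction r′ ¬r

  -- Component sizes for betweenness triples.

  size : V → V → ℕ
  size b v = ∣ ⟦ R? v b ⟧ ∣

  -- What domination betweenness yields in an AT-free graph: a connection from `x` to `v` in G -
  -- N[y] would complete an asteroidal triple, hence `¬r-xv`.
  record Between (x y v : V) : Set where
    field
      r-xy  : R v x y
      r-yv  : R x y v
      ¬r-xv : ¬ R y x v

    far-vx : Far v x
    far-vx = Conn-source r-xy
    far-vy : Far v y
    far-vy = Conn-target r-xy
    far-xy : Far x y
    far-xy = Conn-source r-yv
    far-yv : Far y v
    far-yv = Far-sym far-vy
    far-yx : Far y x
    far-yx = Far-sym far-xy

  Between-sym : ∀ {x y v} → Between x y v → Between v y x
  Between-sym B = record
    { r-xy = Conn-sym r-yv ; r-yv = Conn-sym r-xy ; ¬r-xv = ¬r-xv ∘ Conn-sym }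
    where open Between B

  ATFree⇒Between : ATFree G → ∀ {x y z} → InDomBetweenness G x y z → Between x y z
  ATFree⇒Between atf {x} {y} {z}
    ((x≢y , y≢z , x≢z) , (p , ((wp , _) , _) , p-av) , (q , ((wq , _) , _) , q-av)) = record
    { r-xy = r-xy ; r-yv = r-yz
    ; ¬r-xv = λ r-xz → atf x y z
        ( (x≢y , y≢z , x≢z)
        , (proj₂ (Conn-source r-yz) , proj₂ (Far-sym (Conn-target r-xy)) , proj₂ (Conn-target r-yz))
        , R⇒path r-xy , R⇒path r-yz , R⇒path r-xz) }
    where
    r-xy : R z x y
    r-xy = walk⇒R x≢z wp p-av
    r-yz : R x y z
    r-yz = walk⇒R (x≢y ∘ sym) wq q-av

  -- C_y(b) misses `v`, so it is contained in C_v(b); the vertex `y` makes the inclusion strict.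
  size-< : ∀ {b v y} → R v b y → ¬ R y b v → size b y < size b v
  size-< {b} {v} {y} r ¬r = ∣⟦⟧∣-mono-< (R? y b) (R? v b)
    (R-⊆ (Far-sym (Conn-target r)) ¬r) r (λ c → proj₁ (Conn-target c) refl)

  size-≤ : ∀ {b v y} → Far y v → ¬ R y b v → size b y ≤ size b v
  size-≤ {b} {v} {y} far ¬r = ∣⟦⟧∣-mono-≤ (R? y b) (R? v b) (R-⊆ far ¬r)

  -- If C_y(b) misses `v`, then `size-<` applies. Otherwise it misses `x`, so it lies in C_x(b);
  -- this then contains `v` and, through `r-yv`, also `y`, and `size-<` applies with `x` in place of
  -- `v`.
  Between-size-< : ∀ {x y v} → Between x y v → ∀ {b} → R v b y →
                   size b y < size b v ⊎ size b y < size b x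
  Between-size-< {x} {y} {v} B {b} r with R? y b v
  ... | no ¬r = inj₁ (size-< r ¬r)
  ... | yes r′ = inj₂ (size-< (Conn-trans (R-⊆ far-yx ¬rx r′) (Conn-sym r-yv)) ¬rx)
    where
    open Between B
    ¬rx : ¬ R y b x
    ¬rx rx = ¬r-xv (Conn-trans (Conn-sym rx) r′)

  -- If C_y(b) contained `v`, it would miss `x` and lie in C_x(b), putting `v` and hence `y` into
  -- C_x(b). So it misses `v` and lies in C_v(b).
  Between-size-≤ : ∀ {x y v} → Between x y v → ∀ {b} → ¬ R x b y →
                   size b y ≤ size b v
  Between-size-≤ {x} {y} {v} B {b} ¬x = size-≤ far-yv λ r →
    ¬x (Conn-trans (R-⊆ far-yx (λ rx → ¬r-xv (Conn-trans (Conn-sym rx) r)) r) (Conn-sym r-yv))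
    where open Between B

  Between-size : ∀ {x y v} → Between x y v → ∀ b →
                 size b y < size b v ⊎ size b y < size b x ⊎
                 (size b y ≤ size b v × size b y ≤ size b x)
  Between-size {x} {y} {v} B b with R? v b y
  ... | yes r = map₂ inj₁ (Between-size-< B r)
  ... | no ¬v with R? x b y
  ...   | yes r = [ inj₂ ∘ inj₁ , inj₁ ] (Between-size-< (Between-sym B) r)
  ...   | no ¬x = inj₂ (inj₂ (Between-size-≤ B ¬x , Between-size-≤ (Between-sym B) ¬v))

  sizes : List V → V → List ℕ
  sizes bs v = map (λ b → size b v) bs

  Between-sizes : ∀ {x y v} → Between x y v → ∀ {bs} → x ∈ₗ bs →
                  sizes bs v ≤ₗ sizes bs y → ¬ sizes bs x ≤ₗ sizes bs y
  Between-sizes B (here refl) v≤y _ =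
    <⇒≱ (size-< (Between.r-xy B) (Between.¬r-xv B)) (≤ₗ-head v≤y)
  Between-sizes B {b ∷ _} (there x∈) v≤y x≤y with Between-size B b
  ... | inj₁ y<v        = <⇒≱ y<v (≤ₗ-head v≤y)
  ... | inj₂ (inj₁ y<x) = <⇒≱ y<x (≤ₗ-head x≤y)
  ... | inj₂ (inj₂ (y≤v , y≤x)) = Between-sizes B x∈ (≤ₗ-tail y≤v v≤y) (≤ₗ-tail y≤x x≤y)

  -- Breadth-first search with ties broken by a key

  module BFS (connected : Connected G) (s : V) (key : V → List ℕ) where

    -- `order k` is the vertex visited at time k, `visited k` lists those visited before
    -- time k, and `earliest k v` is the least time i < k with order i ~ v (or k if there
    -- is none).  From k = n on, no vertex is left and `order k` is junk.
    order    : ℕ → V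
    visited  : ℕ → List V
    earliest : ℕ → V → ℕ

    -- With `earliest` in front, a lexicographic minimum obeys the queue rule of BFS, and `key`
    -- decides only between vertices with the same earliest visited neighbour.
    priority : ℕ → V → List ℕ
    priority k v = earliest k v ∷ key v

    unvisited : ℕ → List V
    unvisited k = filter (λ v → ¬? (v ∈? visited k)) (allFin n)

    order zero    = s
    order (suc k) = pick s (priority (suc k)) (unvisited (suc k))

    visited zero    = []
    visited (suc k) = order k ∷ visited k

    earliest zero    v = zero
    earliest (suc k) v with earliest k v <? k | order k ~? v
    ... | yes _ | _     = earliest k v
    ... | no _  | yes _ = k
    ... | no _  | no _  = suc k

    earliest-~ : ∀ k {v} → earliest k v < k → order (earliest k v) ~ v
    earliest-~ (suc k) {v} lt with earliest k v <? k | order k ~? v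
    ... | yes lt′ | _     = earliest-~ k lt′
    ... | no _    | yes e = e
    ... | no _    | no _  = contradiction lt (<-irrefl refl)

    earliest-≤ : ∀ {i k v} → i < k → order i ~ v → earliest k v ≤ i
    earliest-≤ {i} {suc k} {v} (s≤s i≤k) e with earliest k v <? k | order k ~? v | m≤n⇒m<n∨m≡n i≤k
    ... | yes _   | _      | inj₁ i<k  = earliest-≤ i<k e
    ... | yes lt  | _      | inj₂ refl = <⇒≤ lt
    ... | no ¬lt  | _      | inj₁ i<k  = contradiction (≤-<-trans (earliest-≤ i<k e) i<k) ¬lt
    ... | no _    | yes _  | inj₂ refl = ≤-refl
    ... | no _    | no ¬e  | inj₂ refl = contradiction e ¬e

    length-visited : ∀ k → length (visited k) ≡ k
    length-visited zero    = refl
    length-visited (suc k) = cong suc (length-visited k)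

    order∈visited : ∀ {i k} → i < k → order i ∈ₗ visited k
    order∈visited {i} {suc k} (s≤s i≤k) with m≤n⇒m<n∨m≡n i≤k
    ... | inj₁ i<k  = there (order∈visited i<k)
    ... | inj₂ refl = here refl

    visited⇒order : ∀ k {v} → v ∈ₗ visited k → ∃[ i ] (i < k × order i ≡ v)
    visited⇒order (suc k) (here refl) = k , ≤-refl , refl
    visited⇒order (suc k) (there v∈) with visited⇒order k v∈
    ... | i , i<k , eq = i , m≤n⇒m≤1+n i<k , eq

    ∃-unvisited : ∀ {k} → k < n → ∃[ v ] v ∉ₗ visited k
    ∃-unvisited {k} k<n = length<⇒∃∉ (visited k) (subst (_< n) (sym (length-visited k)) k<n)

    unvisited⁺ : ∀ {k v} → v ∉ₗ visited k → v ∈ₗ unvisited k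
    unvisited⁺ {k} {v} = ∈-filter⁺ (λ v → ¬? (v ∈? visited k)) (∈-allFin v)

    order∉visited : ∀ {k} → k < n → order k ∉ₗ visited k
    order∉visited {zero}  _   ()
    order∉visited {suc k} k<n = proj₂ (∈-filter⁻ (λ v → ¬? (v ∈? visited (suc k))) {xs = allFin n}
      (pick-∈ s _ (unvisited⁺ (proj₂ (∃-unvisited k<n)))))

    order-≢ : ∀ {i j} → i < j → j < n → order i ≢ order j
    order-≢ {j = j} i<j j<n eq = order∉visited j<n (subst (_∈ₗ visited j) eq (order∈visited i<j))

    order-injective : ∀ {i j} → i < n → j < n → order i ≡ order j → i ≡ j
    order-injective {i} {j} i<n j<n eq with <-cmp i j
    ... | tri< i<j _ _ = contradiction eq (order-≢ i<j j<n)
    ... | tri≈ _ i≡j _ = i≡j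
    ... | tri> _ _ j<i = contradiction (sym eq) (order-≢ j<i i<n)

    later∉visited : ∀ {j l} → j ≤ l → l < n → order l ∉ₗ visited j
    later∉visited {j} j≤l l<n l∈ with visited⇒order j l∈
    ... | i , i<j , eq = order-≢ (<-≤-trans i<j j≤l) l<n eq

    Unique-visited : ∀ {k} → k ≤ n → Unique (visited k)
    Unique-visited {zero}  _   = []
    Unique-visited {suc k} k<n = ¬Any⇒All¬ _ (order∉visited k<n) ∷ Unique-visited (<⇒≤ k<n)

    all-visited : ∀ v → v ∈ₗ visited n
    all-visited v with v ∈? visited n
    ... | yes v∈ = v∈
    ... | no v∉  = contradiction
      (Unique⇒length≤ (¬Any⇒All¬ _ v∉ ∷ Unique-visited ≤-refl))
      (<⇒≱ (s≤s (≤-reflexive (sym (length-visited n)))))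

    position : ∀ v → ∃[ i ] (i < n × order i ≡ v)
    position v = visited⇒order n (all-visited v)

    τ : Permutation′ n
    τ = permutation (order ∘ toℕ) (λ v → fromℕ< (proj₁ (proj₂ (position v)))) to-from
      (λ i → toℕ-injective (order-injective (toℕ<n _) (toℕ<n i) (to-from (order (toℕ i)))))
      where
      to-from : ∀ v → order (toℕ (fromℕ< (proj₁ (proj₂ (position v))))) ≡ v
      to-from v with position v
      ... | i , i<n , eq = trans (cong order (toℕ-fromℕ< i<n)) eq

    order-τ : ∀ v → order (toℕ (τ ⟨$⟩ˡ v)) ≡ v
    order-τ v = inverseʳ τ

    parent : ℕ → ℕ
    parent j = earliest j (order j)

    order-least : ∀ {j v} → 0 < j → v ∉ₗ visited j → priority j (order j) ≤ₗ priority j v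
    order-least {suc j} _ v∉ = pick-≤ s (priority (suc j)) (unvisited⁺ v∉)

    -- A walk from `s` to an unvisited vertex crosses from visited to unvisited. So some unvisited
    -- vertex has a visited neighbour, and the vertex chosen has one at least as early.
    parent-< : ∀ {j} → 0 < j → j < n → parent j < j
    parent-< {suc j} _ j<n with ∃-unvisited j<n
    ... | w , w∉ with walk-boundary (_∈? visited (suc j)) (proj₁ (proj₂ (connected s w)))
                        (order∈visited z<s) w∉
    ...   | c , d , c∈ , d∉ , c~d with visited⇒order (suc j) c∈
    ...     | i , i<j , refl =
      ≤-<-trans (≤-trans (≤ₗ-head (order-least z<s d∉)) (earliest-≤ i<j c~d)) i<j

    parent-~ : ∀ {j} → 0 < j → j < n → order (parent j) ~ order j
    parent-~ {j} 0<j j<n = earliest-~ j (parent-< 0<j j<n)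

    -- `order l` is still a candidate at time `j`; a neighbour earlier than `parent j` would give it
    -- precedence over `order j`.
    parent-least : ∀ {i j l} → 0 < j → j ≤ l → l < n → i < parent j → ¬ order i ~ order l
    parent-least {i} {j} 0<j j≤l l<n i<p e = <⇒≱ i<p
      (≤-trans (≤ₗ-head (order-least 0<j (later∉visited j≤l l<n)))
        (earliest-≤ (<-trans i<p (parent-< 0<j (≤-<-trans j≤l l<n))) e))

    parent-mono : ∀ {i j} → 0 < i → i < j → j < n → parent i ≤ parent j
    parent-mono 0<i i<j j<n = ≮⇒≥ λ lt →
      parent-least 0<i (<⇒≤ i<j) j<n lt (parent-~ (≤-<-trans z≤n i<j) j<n)

    -- The edge makes the `earliest` value of `order l` at most `parent j`, so the choice of
    -- `order j` must have been justified by `key`.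
    siblings-key : ∀ {j l} → 0 < j → j ≤ l → l < n → order (parent j) ~ order l →
                   key (order j) ≤ₗ key (order l)
    siblings-key 0<j j≤l l<n e =
      ≤ₗ-tail (earliest-≤ (parent-< 0<j (≤-<-trans j≤l l<n)) e) (order-least 0<j (later∉visited j≤l l<n))

    -- Induction along the BFS tree path, on which times only decrease towards `s`.
    root-path : ∀ {P : Pred V 0ℓ} i → i < n → (∀ m → m ≤ i → P (order m)) → Conn P s (order i)
    root-path {P} = <-rec _ λ where
      zero    rec _   Pm → end (Pm 0 z≤n)
      (suc i) rec i<n Pm → let p<i = parent-< z<s i<n in
        Conn-snoc (rec p<i (<-trans p<i i<n) (λ m m≤p → Pm m (≤-trans m≤p (<⇒≤ p<i))))
                  (parent-~ z<s i<n) (Pm (suc i) ≤-refl)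

    τ-BFSOrder : BFSOrder G s τ
    -- By connectivity every later vertex has a visited parent, so no new search phase starts and
    -- the first alternative always holds.
    τ-BFSOrder = (λ z z≡0 → cong order z≡0) , λ i j j≡1+i → inj₁ (next-vertex i j j≡1+i)
      where
      next-vertex : ∀ (i j : Fin n) → toℕ j ≡ suc (toℕ i) →
        ∃[ k ] (k Fin.≤ i × order (toℕ k) ~ order (toℕ j) ×
          (∀ k′ → k′ Fin.< k → ¬ (∃[ m ] (i Fin.< m × order (toℕ k′) ~ order (toℕ m)))))
      next-vertex i j j≡1+i =
          k
        , ≤-pred (subst (toℕ k <_) j≡1+i (subst (_< toℕ j) (sym k≡p) p<j))
        , subst (λ p → order p ~ order (toℕ j)) (sym k≡p) (parent-~ 0<j (toℕ<n j))
        , λ k′ k′<k (m , i<m , e) →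
            parent-least 0<j (subst (_≤ toℕ m) (sym j≡1+i) i<m) (toℕ<n m) (subst (toℕ k′ <_) k≡p k′<k) e
        where
        0<j : 0 < toℕ j
        0<j = subst (0 <_) (sym j≡1+i) z<s
        p<j : parent (toℕ j) < toℕ j
        p<j = parent-< 0<j (toℕ<n j)
        k : Fin n
        k = fromℕ< (<-trans p<j (toℕ<n j))
        k≡p : toℕ k ≡ parent (toℕ j)
        k≡p = toℕ-fromℕ< _

  -- BFS with component-size tie-breaking yields an AT-free order.

  module _ (connected : Connected G) (s : V) where

    -- The leading base `s` serves `not-other-parent`; `allFin n` ensures that `x` is among the
    -- bases in `not-same-parent`.
    open BFS connected s (sizes (s ∷ allFin n))

    Between-not-last : ∀ {i j l} → i < j → j < l → l < n → ¬ Between (order i) (order l) (order j)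
    Between-not-last {i} {j} {l} i<j j<l l<n B = by-cases (order u ~? y)
      where
      open Between B
      x = order i
      v = order j
      y = order l
      u = parent j

      0<j : 0 < j
      0<j = ≤-<-trans z≤n i<j
      j<n : j < n
      j<n = <-trans j<l l<n
      u<j : u < j
      u<j = parent-< 0<j j<n
      u~v : order u ~ v
      u~v = parent-~ 0<j j<n

      before-u-far : ∀ {k} → j ≤ k → k < n → ∀ m → m < u → Far (order k) (order m)
      before-u-far j≤k k<n m m<u =
        order-≢ (<-≤-trans (<-trans m<u u<j) j≤k) k<n , parent-least 0<j j≤k k<n m<u ∘ ~-sym

      -- `P x` is a separate assumption because `x` may be visited after `u`, whereas its parent is
      -- never later than `u`. For `i` zero, `x` is `s` itself.
      root-path-x : ∀ {P : Pred V 0ℓ} → P x → (0 < i → ∀ m → m ≤ parent i → P (order m)) → Conn P s x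
      root-path-x Px Pm with m≤n⇒m<n∨m≡n (z≤n {i})
      ... | inj₂ refl = end Px
      ... | inj₁ 0<i  = Conn-snoc (root-path (parent i) (<-trans (parent-< 0<i i<n) i<n) (Pm 0<i))
                          (parent-~ 0<i i<n) Px
        where
        i<n : i < n
        i<n = <-trans i<j j<n

      -- All vertices up to time `u` are outside N[y], so the tree paths from `s` to `x` and to `v`
      -- join `x` to `v` in G - N[y].
      not-adjacent : ¬ order u ~ y → ⊥
      not-adjacent u≁y = ¬r-xv (Conn-trans
        (Conn-sym (root-path-x far-yx λ 0<i m m≤p → upto-u m (≤-trans m≤p (parent-mono 0<i i<j j<n))))
        (Conn-snoc (root-path u (<-trans u<j j<n) upto-u) u~v far-yv))
        where
        upto-u : ∀ m → m ≤ u → Far y (order m)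
        upto-u m m≤u with m≤n⇒m<n∨m≡n m≤u
        ... | inj₁ m<u  = before-u-far (<⇒≤ j<l) l<n m m<u
        ... | inj₂ refl = order-≢ (<-trans u<j j<l) l<n , u≁y ∘ ~-sym

      -- Before reaching `x`, the tree path from `s` uses only times below `u`, so it lies outside
      -- N[v] and N[y]. Thus C_v(s) contains `x` and with it `y`, while C_y(s) contains `x` and so
      -- misses `v`.
      not-other-parent : order u ~ y → (0 < i → parent i < u) → ⊥
      not-other-parent u~y p<u = <⇒≱
        (size-< (Conn-trans (to-x ≤-refl j<n far-vx) r-xy)
                (λ r → ¬r-xv (Conn-trans (Conn-sym (to-x (<⇒≤ j<l) l<n far-yx)) r)))
        (≤ₗ-head (siblings-key 0<j (<⇒≤ j<l) l<n u~y))
        where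
        to-x : ∀ {k} → j ≤ k → k < n → Far (order k) x → R (order k) s x
        to-x j≤k k<n far = root-path-x far λ 0<i m m≤p →
          before-u-far j≤k k<n m (≤-<-trans m≤p (p<u 0<i))

      not-same-parent : order u ~ y → 0 < i → parent i ≡ u → ⊥
      not-same-parent u~y 0<i p≡u = Between-sizes B (there (∈-allFin x))
        (siblings-key 0<j (<⇒≤ j<l) l<n u~y)
        (siblings-key 0<i (<⇒≤ (<-trans i<j j<l)) l<n
          (subst (λ p → order p ~ y) (sym p≡u) u~y))

      by-cases : Dec (order u ~ y) → ⊥
      by-cases (no u≁y)  = not-adjacent u≁y
      by-cases (yes u~y) = not-other-parent u~y λ 0<i →
        [ id , (λ p≡u → contradiction p≡u (not-same-parent u~y 0<i)) ]
          (m≤n⇒m<n∨m≡n (parent-mono 0<i i<j j<n))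

    τ-ATFreeOrder : ATFree G → ATFreeOrder G τ
    τ-ATFreeOrder atf x y z xyz@((x≢y , y≢z , x≢z) , _) =
      by-cases (pos y <? pos x) (pos y <? pos z)
      where
      pos : V → ℕ
      pos w = toℕ (τ ⟨$⟩ˡ w)

      ≮⇒pos-> : ∀ {a b} → a ≢ b → ¬ pos b < pos a → pos a < pos b
      ≮⇒pos-> {a} {b} a≢b b≮a with m≤n⇒m<n∨m≡n (≮⇒≥ b≮a)
      ... | inj₁ lt = lt
      ... | inj₂ eq = contradiction (trans (sym (order-τ a)) (trans (cong order eq) (order-τ b))) a≢b

      not-last : ∀ {a b} → Between a y b → pos a < pos b → ¬ pos b < pos y
      not-last {a} {b} B a<b b<y = Between-not-last a<b b<y (toℕ<n _)
        -- `Between-not-last` speaks of vertices given by their times, so the triple is rewritten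
        -- through `order-τ`.
        (subst (λ b → Between _ _ b) (sym (order-τ b))
          (subst (λ a → Between a _ b) (sym (order-τ a))
            (subst (λ y → Between a y b) (sym (order-τ y)) B)))

      B : Between x y z
      B = ATFree⇒Between atf xyz

      by-cases : Dec (pos y < pos x) → Dec (pos y < pos z) → pos y < pos x ⊎ pos y < pos z
      by-cases (yes y<x) _ = inj₁ y<x
      by-cases (no _) (yes y<z) = inj₂ y<z
      by-cases (no y≮x) (no y≮z) with pos x <? pos z
      -- Here `y` comes after both ends; the symmetry of `Between` allows either end to come first.
      ... | yes x<z = contradiction (≮⇒pos-> (y≢z ∘ sym) y≮z) (not-last B x<z)
      ... | no x≮z  = contradiction (≮⇒pos-> x≢y y≮x)
                        (not-last (Between-sym B) (≮⇒pos-> (x≢z ∘ sym) x≮z))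

theorem2 : ∀ {n : ℕ} (G : Graph n) → Connected G → ATFree G →
    ∀ (s : Fin n) → ∃[ τ ] (ATFreeOrder G τ × BFSOrder G s τ)
theorem2 {n} G connected atf s =
    τ , τ-ATFreeOrder G connected s atf , τ-BFSOrder
  where open BFS G connected s (sizes G (s ∷ allFin n))
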